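{- Let $n, k$ be positive integers with $n \geq 3k-3 \geq 3$. Then $$g(n,k,3) \leq \binom{n}{k-1}+2\binom{n}{k-3}+3\binom{n-1}{k-3}.$$
   Context: Let $[n]=\{1,\dots,n\}$ and let $\binom{[n]}{k}$ be the family of all $k$-element subsets of $[n]$. For sets $A,B,C\subset[n]$ put $d(A,B,C)=|A\cap B|+|B\cap C|+|C\cap A|$. For a positive integer $\ell$, let $\mathbf{H}_\ell$ be the class of families $\mathcal{H}$ of subsets of $[n]$ such that $d(A,B,C)\ge \ell$ for all $A,B,C\in\mathcal{H}$ (no distinctness of $A,B,C$ is required in this definition). Define $g(n,k,\ell)=\max\{|\mathcal{F}| : \mathcal{F}\subset\binom{[n]}{k},\ \mathcal{F}\in\mathbf{H}_\ell\}$. A binomial coefficient $\binom{a}{b}$ with $b<0$ is $0$. -}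

module Defs where

open import Data.Bool using (true; false)
import Data.Bool.Properties as Bool
open import Data.Empty using (⊥)
open import Data.Fin.Subset using (Subset; inside; outside; ∣_∣; _∩_)
open import Data.Integer using (ℤ; +_; -[1+_])
open import Data.List using (List; []; _∷_; _++_; map; filter; length)
open import Data.List.Extrema.Nat using (argmax; argmax-sel; f[xs]≤f[argmax])
open import Data.List.Membership.Propositional using (_∈_)
open import Data.List.Membership.Propositional.Properties using (∈-map⁺; ∈-map⁻; ∈-++⁺ˡ; ∈-++⁺ʳ; ∈-++⁻; ∈-filter⁺; ∈-filter⁻)
open import Data.List.Membership.Propositional.Properties.WithK using (unique∧set⇒bag)
open import Data.List.Relation.Binary.BagAndSetEquality using (∼bag⇒↭)
open import Data.List.Relation.Binary.Permutation.Propositional.Properties using (↭-length)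
open import Data.List.Relation.Binary.Sublist.Propositional using (_⊆_; []; _∷_; _∷ʳ_)
open import Data.List.Relation.Binary.Sublist.Propositional.Properties using (All-resp-⊆)
open import Data.List.Relation.Unary.All as All using (All; []; _∷_; all?)
open import Data.List.Relation.Unary.Any using (here; any?)
open import Data.List.Relation.Unary.AllPairs using ([]; _∷_)
open import Data.List.Relation.Unary.Unique.Propositional using (Unique)
import Data.List.Relation.Unary.Unique.Propositional.Properties as Unique
open import Data.Nat using (ℕ; zero; suc; _+_; _≤_; _≟_; _≤?_)
open import Data.Nat.Combinatorics using (_C_)
open import Data.Product using (∃; _×_; _,_; proj₁; proj₂)
open import Data.Sum using (inj₁; inj₂)
open import Data.Vec using ([]; _∷_)
open import Data.Vec.Properties using (≡-dec; ∷-injectiveʳ)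
open import Function using (mk⇔)
open import Relation.Binary.PropositionalEquality using (_≡_; refl; sym; subst)
open import Relation.Nullary using (does)
open import Relation.Nullary.Decidable using (map′)
open import Relation.Unary using (Decidable)

-- A subset of [n] is a `Subset n`, with Fin n playing the role of [n].  A
-- family of subsets is a list of them; duplicate-freeness, which makes
-- `length` the cardinality, is required wherever a cardinality is taken.

Family : ℕ → Set
Family n = List (Subset n)

d : ∀ {n} → Subset n → Subset n → Subset n → ℕ
d A B C = ∣ A ∩ B ∣ + ∣ B ∩ C ∣ + ∣ C ∩ A ∣

-- A, B, C need not be distinct.
H : ∀ {n} → ℕ → Family n → Set
H ℓ 𝓗 = ∀ {A B C} → A ∈ 𝓗 → B ∈ 𝓗 → C ∈ 𝓗 → ℓ ≤ d A B C

H? : ∀ {n} ℓ → Decidable (H {n} ℓ)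
H? ℓ 𝓗 = map′
  (λ h A∈ B∈ C∈ → All.lookup (All.lookup (All.lookup h A∈) B∈) C∈)
  (λ h → All.tabulate λ A∈ → All.tabulate λ B∈ → All.tabulate λ C∈ → h A∈ B∈ C∈)
  (all? (λ A → all? (λ B → all? (λ C → ℓ ≤? d A B C) 𝓗) 𝓗) 𝓗)

subsets : ∀ n → Family n
subsets zero    = [] ∷ []
subsets (suc n) = map (inside ∷_) (subsets n) ++ map (outside ∷_) (subsets n)

-- The family of all k-element subsets of [n].
layer : ∀ n → ℕ → Family n
layer n k = filter (λ A → ∣ A ∣ ≟ k) (subsets n)

-- For a duplicate-free list, these are its subfamilies, each listed once.
sublists : ∀ {a} {X : Set a} → List X → List (List X)
sublists []       = [] ∷ []
sublists (x ∷ xs) = map (x ∷_) (sublists xs) ++ sublists xs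

-- The default value [] of argmax is itself one of the candidates.
g : ℕ → ℕ → ℕ → ℕ
g n k ℓ = length (argmax length [] (filter (H? ℓ) (sublists (layer n k))))

-- Binomial coefficients with integer lower index, zero when it is negative.
binom : ℕ → ℤ → ℕ
binom n (+ k)    = n C k
binom n -[1+ _ ] = 0

------------------------------------------------------------------------
-- g n k ℓ is the maximum size of a k-uniform family in H ℓ: it is attained
-- (g-attained), and no such family is larger (g-upper).

Admissible : ∀ n → ℕ → ℕ → Family n → Set
Admissible n k ℓ 𝓕 = Unique 𝓕 × All (λ A → ∣ A ∣ ≡ k) 𝓕 × H ℓ 𝓕

∈-subsets : ∀ {n} (A : Subset n) → A ∈ subsets n
∈-subsets []          = here refl
∈-subsets (true  ∷ A) = ∈-++⁺ˡ (∈-map⁺ (inside ∷_) (∈-subsets A))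
∈-subsets {suc n} (false ∷ A) =
  ∈-++⁺ʳ (map (inside ∷_) (subsets n)) (∈-map⁺ (outside ∷_) (∈-subsets A))

subsets-unique : ∀ n → Unique (subsets n)
subsets-unique zero    = [] ∷ []
subsets-unique (suc n) = Unique.++⁺
  (Unique.map⁺ ∷-injectiveʳ (subsets-unique n))
  (Unique.map⁺ ∷-injectiveʳ (subsets-unique n))
  disjoint
  where
  disjoint : ∀ {A} → A ∈ map (inside ∷_) (subsets n) × A ∈ map (outside ∷_) (subsets n) → ⊥
  disjoint (p , q) with ∈-map⁻ (inside ∷_) p | ∈-map⁻ (outside ∷_) q
  ... | _ , _ , refl | _ , _ , ()

layer-unique : ∀ n k → Unique (layer n k)
layer-unique n k = Unique.filter⁺ (λ A → ∣ A ∣ ≟ k) (subsets-unique n)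

layer-uniform : ∀ n k → All (λ A → ∣ A ∣ ≡ k) (layer n k)
layer-uniform n k = All.tabulate λ A∈ → proj₂ (∈-filter⁻ (λ A → ∣ A ∣ ≟ k) {xs = subsets n} A∈)

∈-layer : ∀ {n k} {A : Subset n} → ∣ A ∣ ≡ k → A ∈ layer n k
∈-layer {k = k} {A} ∣A∣≡k = ∈-filter⁺ (λ A → ∣ A ∣ ≟ k) (∈-subsets A) ∣A∣≡k

Unique-resp-⊆ : ∀ {a} {X : Set a} {xs ys : List X} → xs ⊆ ys → Unique ys → Unique xs
Unique-resp-⊆ []         []       = []
Unique-resp-⊆ (_ ∷ʳ p)   (_ ∷ u)  = Unique-resp-⊆ p u
Unique-resp-⊆ (refl ∷ p) (x∉ ∷ u) = All-resp-⊆ p x∉ ∷ Unique-resp-⊆ p u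

∈-sublists⇒⊆ : ∀ {a} {X : Set a} (ys : List X) {xs} → xs ∈ sublists ys → xs ⊆ ys
∈-sublists⇒⊆ []       (here refl) = []
∈-sublists⇒⊆ (y ∷ ys) xs∈ with ∈-++⁻ (map (y ∷_) (sublists ys)) xs∈
... | inj₂ q = y ∷ʳ ∈-sublists⇒⊆ ys q
... | inj₁ q with ∈-map⁻ (y ∷_) q
...   | _ , r , refl = refl ∷ ∈-sublists⇒⊆ ys r

⊆⇒∈-sublists : ∀ {a} {X : Set a} {xs ys : List X} → xs ⊆ ys → xs ∈ sublists ys
⊆⇒∈-sublists []                    = here refl
⊆⇒∈-sublists {ys = _ ∷ ys} (y ∷ʳ p) = ∈-++⁺ʳ (map (y ∷_) (sublists ys)) (⊆⇒∈-sublists p)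
⊆⇒∈-sublists (refl ∷ p)            = ∈-++⁺ˡ (∈-map⁺ (_ ∷_) (⊆⇒∈-sublists p))

filter⊆ : ∀ {a p} {X : Set a} {P : X → Set p} (P? : Decidable P) xs → filter P? xs ⊆ xs
filter⊆ P? []       = []
filter⊆ P? (x ∷ xs) with does (P? x)
... | true  = refl ∷ filter⊆ P? xs
... | false = x ∷ʳ filter⊆ P? xs

g-attained : ∀ n k ℓ → ∃ λ 𝓕 → Admissible n k ℓ 𝓕 × length 𝓕 ≡ g n k ℓ
g-attained n k ℓ = 𝓖 , admissible , refl
  where
  candidates : List (Family n)
  candidates = filter (H? ℓ) (sublists (layer n k))
  𝓖 : Family n
  𝓖 = argmax length [] candidates
  admissible : Admissible n k ℓ 𝓖
  admissible with argmax-sel length [] candidates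
  ... | inj₁ 𝓖≡[] = subst (Admissible n k ℓ) (sym 𝓖≡[]) ([] , [] , λ ())
  ... | inj₂ 𝓖∈   with ∈-filter⁻ (H? ℓ) {xs = sublists (layer n k)} 𝓖∈
  ...   | 𝓖∈sub , h =
    let 𝓖⊆ = ∈-sublists⇒⊆ (layer n k) 𝓖∈sub in
    Unique-resp-⊆ 𝓖⊆ (layer-unique n k) , All-resp-⊆ 𝓖⊆ (layer-uniform n k) , h

g-upper : ∀ n k ℓ 𝓕 → Admissible n k ℓ 𝓕 → length 𝓕 ≤ g n k ℓ
g-upper n k ℓ 𝓕 (unique , uniform , h) =
  subst (_≤ g n k ℓ) (↭-length (∼bag⇒↭ (unique∧set⇒bag 𝓕′-unique unique (mk⇔ to from))))
    (All.lookup (f[xs]≤f[argmax] {f = length} [] _) 𝓕′∈)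
  where
  _∈𝓕? : Decidable (_∈ 𝓕)
  A ∈𝓕? = any? (≡-dec Bool._≟_ A) 𝓕
  -- 𝓕 rearranged in the order of layer n k.
  𝓕′ : Family n
  𝓕′ = filter _∈𝓕? (layer n k)
  𝓕′-unique : Unique 𝓕′
  𝓕′-unique = Unique.filter⁺ _∈𝓕? (layer-unique n k)
  to : ∀ {A} → A ∈ 𝓕′ → A ∈ 𝓕
  to A∈ = proj₂ (∈-filter⁻ _∈𝓕? {xs = layer n k} A∈)
  from : ∀ {A} → A ∈ 𝓕 → A ∈ 𝓕′
  from A∈ = ∈-filter⁺ _∈𝓕? (∈-layer (All.lookup uniform A∈)) A∈
  𝓕′∈ : 𝓕′ ∈ filter (H? ℓ) (sublists (layer n k))
  𝓕′∈ = ∈-filter⁺ (H? ℓ) (⊆⇒∈-sublists (filter⊆ _∈𝓕? (layer n k)))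
    (λ A∈ B∈ C∈ → h (to A∈) (to B∈) (to C∈))

{-# OPTIONS --safe #-}

-- Write k = j + 1.  The right-hand side satisfies Pascal's recurrence, so one
-- inducts on n.  For n = 3j it equals C(n, k), and k = 1 is immediate.  For
-- n > 3j, shift one fixed element into all the others until the family is
-- stable; shifting preserves the size and the condition d ≥ 3.  The members
-- avoiding the element then form a family for (n - 1, k), and the others, with
-- the element deleted, one for (n - 1, k - 1): if three of the latter had
-- d = 0, 1 or 2 after deletion, stability would allow moving the element, in
-- one or two of them, to other points so that the total d stays at most 2.

module Submission where

open import Defs
open import Data.Bool using (Bool; true; false; _∧_; _∨_; T; if_then_else_)
import Data.Bool.Properties as Bool
open import Data.Empty using (⊥-elim)
open import Data.Fin using (Fin; zero; suc)
open import Data.Fin.Properties using (any?)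
open import Data.Fin.Subset using (Subset; inside; outside; ∣_∣; _∩_)
open import Data.Fin.Subset.Properties using (anySubset?; ∣p∩q∣≤∣p∣; ∣p∩q∣≤∣q∣; ∩-idem; ∩-comm)
open import Data.List using ([]; _∷_; _++_; map; filter; length)
open import Data.List.Membership.Propositional using (_∈_)
open import Data.List.Membership.Propositional.Properties using (∈-filter⁺; ∈-filter⁻)
open import Data.List.Membership.Propositional.Properties.WithK using (unique∧set⇒bag)
open import Data.List.Properties using (filter-++; length-++)
open import Data.List.Relation.Binary.BagAndSetEquality using (∼bag⇒↭)
open import Data.List.Relation.Binary.Permutation.Propositional.Properties using (↭-length)
import Data.List.Relation.Unary.All as All
import Data.List.Relation.Unary.Any as Any
import Data.List.Relation.Unary.Unique.Propositional.Properties as Unique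
open import Data.Nat using (ℕ; zero; suc; _+_; _*_; _∸_; _<_; _≤_; _≥_; z≤n; s≤s; s≤s⁻¹; _≤?_)
open import Data.Nat.Combinatorics using (_C_; nCk≡nC[n∸k]; nCn≡1; nCk+nC[k+1]≡[n+1]C[k+1])
open import Data.Nat.Induction using (<-rec)
open import Data.Nat.Properties
open import Data.Nat.Tactic.RingSolver using (solve-∀)
open import Data.Product using (∃; _×_; _,_; proj₂)
import Data.Product as Product
open import Data.Sum using (inj₁; inj₂)
open import Data.Vec using ([]; _∷_; lookup; _[_]≔_)
open import Data.Vec.Properties using (≡-dec; []≔-lookup; []≔-idempotent; lookup∘update)
open import Function using (_∘_; id; mk⇔; Equivalence)
open import Relation.Binary.PropositionalEquality
open import Relation.Nullary using (¬_; Dec; yes; no; does; contradiction)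
open import Relation.Nullary.Decidable using (_×-dec_; ¬?; T?; decidable-stable)
open import Relation.Unary using (Decidable)

private variable
  m n k : ℕ

-- Binomial coefficients

nC0≡1 : ∀ n → n C 0 ≡ 1
nC0≡1 n = trans (nCk≡nC[n∸k] {0} {n} z≤n) (nCn≡1 n)

pascal : ∀ n k → suc n C suc k ≡ n C k + n C suc k
pascal n k = sym (nCk+nC[k+1]≡[n+1]C[k+1] n k)

-- Induction on `n` by Pascal's rule: the left side breaks into one spare copy of `a` and the
-- induction hypotheses at `k` and `suc k`, which Pascal's rule joins again.
absorption : ∀ n k → suc k * (suc n C suc k) ≡ suc n * (n C k)
absorption zero    zero    = refl
absorption zero    (suc k) = *-zeroʳ (suc (suc k))
absorption (suc n) zero    rewrite pascal (suc n) 0 | nC0≡1 (suc n) =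
  cong suc (trans (absorption n zero) (cong (suc n *_) (nC0≡1 n)))
absorption (suc n) (suc k) = begin
  suc (suc k) * (suc (suc n) C suc (suc k))  ≡⟨ cong (suc (suc k) *_) (pascal (suc n) (suc k)) ⟩
  suc (suc k) * (a + b)                      ≡⟨ split k a b ⟩
  a + (suc k * a + suc (suc k) * b)          ≡⟨ cong (a +_) (cong₂ _+_ (absorption n k) (absorption n (suc k))) ⟩
  a + (suc n * (n C k) + suc n * (n C suc k)) ≡⟨ cong (a +_) (*-distribˡ-+ (suc n) (n C k) _) ⟨
  a + suc n * (n C k + n C suc k)            ≡⟨ cong (λ z → a + suc n * z) (pascal n k) ⟨
  suc (suc n) * a                            ∎
  where
  open ≡-Reasoning
  a = suc n C suc k
  b = suc n C suc (suc k)
  split : ∀ k a b → suc (suc k) * (a + b) ≡ a + (suc k * a + suc (suc k) * b)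
  split = solve-∀

-- The ratio of consecutive coefficients, with upper index `k + r` so that no truncated subtraction
-- occurs. Compare `absorption` with Pascal's rule and cancel `suc k * a`.
C-step : ∀ k r → suc k * ((k + r) C suc k) ≡ r * ((k + r) C k)
C-step k r = +-cancelˡ-≡ (suc k * a) _ _ (begin
  suc k * a + suc k * b          ≡⟨ *-distribˡ-+ (suc k) a b ⟨
  suc k * (a + b)                ≡⟨ cong (suc k *_) (pascal (k + r) k) ⟨
  suc k * (suc (k + r) C suc k)  ≡⟨ absorption (k + r) k ⟩
  (suc k + r) * a                ≡⟨ *-distribʳ-+ a (suc k) r ⟩
  suc k * a + r * a              ∎)
  where
  open ≡-Reasoning
  a = (k + r) C k
  b = (k + r) C suc k

-- The bound for k = suc j.
bound : ℕ → ℕ → ℕ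
bound n zero          = n C 0
bound n (suc zero)    = n C 1
bound n (suc (suc i)) = n C suc (suc i) + 2 * (n C i) + 3 * ((n ∸ 1) C i)

-- Pascal's rule term by term. The last term has upper index `n ∸ 1`, and `1 ≤ m` makes this a true
-- subtraction at both `suc m` and `m`.
bound-pascal : 1 ≤ m → ∀ j → bound (suc m) (suc j) ≡ bound m j + bound m (suc j)
bound-pascal {suc m} (s≤s _) zero = pascal (suc m) 0
bound-pascal {suc m} (s≤s _) (suc zero)
  rewrite pascal (suc m) 1 | nC0≡1 (suc m) | nC0≡1 (suc (suc m)) | nC0≡1 m =
  trans (+-assoc (a + b) 2 3) (trans (+-assoc a b 5) (cong (a +_) (sym (+-assoc b 2 3))))
  where
  a = suc m C 1
  b = suc m C 2
bound-pascal {suc m} (s≤s _) (suc (suc i))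
  rewrite pascal (suc m) (suc (suc i)) | pascal (suc m) i | pascal m i =
  regroup (suc m C suc (suc i)) _ (suc m C i) _ (m C i) _
  where
  regroup : ∀ a b c d e f → a + b + 2 * (c + d) + 3 * (e + f) ≡ a + 2 * c + 3 * e + (b + 2 * d + 3 * f)
  regroup = solve-∀

-- The start n = 3j of the induction, with j = i + 2, where the full layer has exactly the size of
-- the bound. The factor (2 + i)(3 + i) clears denominators; the ratios `e₃`, `e₂`, `e₁`, `e₀` then
-- descend from `c₃` to `c₀` and `b`, and each split peels off a term of the right side.
C-3j : ∀ i → (6 + 3 * i) C (3 + i) ≡ bound (6 + 3 * i) (2 + i)
C-3j i = *-cancelˡ-≡ _ _ ((2 + i) * (3 + i)) (begin
  (2 + i) * (3 + i) * c₃                                              ≡⟨ *-assoc (2 + i) (3 + i) c₃ ⟩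
  (2 + i) * ((3 + i) * c₃)                                            ≡⟨ cong ((2 + i) *_) e₃ ⟩
  (2 + i) * ((4 + 2 * i) * c₂)                                        ≡⟨ split₁ i c₂ ⟩
  (2 + i) * (3 + i) * c₂ + (1 + i) * ((2 + i) * c₂)                   ≡⟨ cong (λ z → (2 + i) * (3 + i) * c₂ + (1 + i) * z) e₂ ⟩
  (2 + i) * (3 + i) * c₂ + (1 + i) * ((5 + 2 * i) * c₁)               ≡⟨ cong ((2 + i) * (3 + i) * c₂ +_) (swap₁ i c₁) ⟩
  (2 + i) * (3 + i) * c₂ + (5 + 2 * i) * ((1 + i) * c₁)               ≡⟨ cong (λ z → (2 + i) * (3 + i) * c₂ + (5 + 2 * i) * z) e₁ ⟩
  (2 + i) * (3 + i) * c₂ + (5 + 2 * i) * ((6 + 2 * i) * c₀)           ≡⟨ split₂ i c₂ c₀ ⟩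
  (2 + i) * (3 + i) * (c₂ + 2 * c₀) + (3 + i) * ((6 + 2 * i) * c₀)    ≡⟨ cong (λ z → (2 + i) * (3 + i) * (c₂ + 2 * c₀) + (3 + i) * z) e₀ ⟨
  (2 + i) * (3 + i) * (c₂ + 2 * c₀) + (3 + i) * ((6 + 3 * i) * b)     ≡⟨ join i (c₂ + 2 * c₀) b ⟩
  (2 + i) * (3 + i) * (c₂ + 2 * c₀ + 3 * b)                           ∎)
  where
  open ≡-Reasoning
  N = 6 + 3 * i
  c₀ = N C i
  c₁ = N C (1 + i)
  c₂ = N C (2 + i)
  c₃ = N C (3 + i)
  b = (5 + 3 * i) C i
  step : ∀ k r → k + r ≡ N → suc k * (N C suc k) ≡ r * (N C k)
  step k r k+r≡N = subst (λ z → suc k * (z C suc k) ≡ r * (z C k)) k+r≡N (C-step k r)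
  sum₀ : ∀ i → i + (6 + 2 * i) ≡ 6 + 3 * i
  sum₀ = solve-∀
  sum₁ : ∀ i → 1 + i + (5 + 2 * i) ≡ 6 + 3 * i
  sum₁ = solve-∀
  sum₂ : ∀ i → 2 + i + (4 + 2 * i) ≡ 6 + 3 * i
  sum₂ = solve-∀
  e₁ : (1 + i) * c₁ ≡ (6 + 2 * i) * c₀
  e₁ = step i _ (sum₀ i)
  e₂ : (2 + i) * c₂ ≡ (5 + 2 * i) * c₁
  e₂ = step (1 + i) _ (sum₁ i)
  e₃ : (3 + i) * c₃ ≡ (4 + 2 * i) * c₂
  e₃ = step (2 + i) _ (sum₂ i)
  e₀ : (6 + 3 * i) * b ≡ (6 + 2 * i) * c₀
  e₀ = trans (sym (absorption (5 + 3 * i) i)) e₁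
  split₁ : ∀ i c → (2 + i) * ((4 + 2 * i) * c) ≡ (2 + i) * (3 + i) * c + (1 + i) * ((2 + i) * c)
  split₁ = solve-∀
  swap₁ : ∀ i c → (1 + i) * ((5 + 2 * i) * c) ≡ (5 + 2 * i) * ((1 + i) * c)
  swap₁ = solve-∀
  split₂ : ∀ i c a → (2 + i) * (3 + i) * c + (5 + 2 * i) * ((6 + 2 * i) * a)
                   ≡ (2 + i) * (3 + i) * (c + 2 * a) + (3 + i) * ((6 + 2 * i) * a)
  split₂ = solve-∀
  join : ∀ i c b → (2 + i) * (3 + i) * c + (3 + i) * ((6 + 3 * i) * b) ≡ (2 + i) * (3 + i) * (c + 3 * b)
  join = solve-∀

layer≤bound : ∀ i → (3 * suc i) C suc (suc i) ≤ bound (3 * suc i) (suc i)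
-- Here n = 3 and k = 2, and C(3, 2) = C(3, 1).
layer≤bound zero    = ≤-refl
layer≤bound (suc i) = subst (λ z → z C (3 + i) ≤ bound z (2 + i)) (3*[2+i] i) (≤-reflexive (C-3j i))
  where
  3*[2+i] : ∀ i → 6 + 3 * i ≡ 3 * suc (suc i)
  3*[2+i] = solve-∀

-- Sums over all subsets

⟦_⟧ : Bool → ℕ
⟦ b ⟧ = if b then 1 else 0

sumOver : (Subset n → ℕ) → ℕ
sumOver {zero}  f = f []
sumOver {suc n} f = sumOver (f ∘ (inside ∷_)) + sumOver (f ∘ (outside ∷_))

sumOver-mono : {f g : Subset n → ℕ} → (∀ A → f A ≤ g A) → sumOver f ≤ sumOver g
sumOver-mono {zero}  f≤g = f≤g []
sumOver-mono {suc n} f≤g = +-mono-≤ (sumOver-mono (f≤g ∘ (inside ∷_))) (sumOver-mono (f≤g ∘ (outside ∷_)))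

sumOver-mono-< : {f g : Subset n → ℕ} → (∀ A → f A ≤ g A) → ∀ A → f A < g A → sumOver f < sumOver g
sumOver-mono-< f≤g []          lt = lt
sumOver-mono-< f≤g (true  ∷ A) lt =
  +-mono-<-≤ (sumOver-mono-< (f≤g ∘ (inside ∷_)) A lt) (sumOver-mono (f≤g ∘ (outside ∷_)))
sumOver-mono-< f≤g (false ∷ A) lt =
  +-mono-≤-< (sumOver-mono (f≤g ∘ (inside ∷_))) (sumOver-mono-< (f≤g ∘ (outside ∷_)) A lt)

sumOver-cong : {f g : Subset n → ℕ} → (∀ A → f A ≡ g A) → sumOver f ≡ sumOver g
sumOver-cong {zero}  f≡g = f≡g []
sumOver-cong {suc n} f≡g = cong₂ _+_ (sumOver-cong (f≡g ∘ (inside ∷_))) (sumOver-cong (f≡g ∘ (outside ∷_)))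

sumOver-+ : (f g : Subset n → ℕ) → sumOver (λ A → f A + g A) ≡ sumOver f + sumOver g
sumOver-+ {zero}  f g = refl
sumOver-+ {suc n} f g = trans (cong₂ _+_ (sumOver-+ {n} _ _) (sumOver-+ {n} _ _))
  (interchange (sumOver (f ∘ (inside ∷_))) _ _ _)
  where
  interchange : ∀ a b c d → a + b + (c + d) ≡ a + c + (b + d)
  interchange = solve-∀

-- A shift exchanges members between A and A ∪ {x}, so the summands need not agree set by set but
-- only on each such pair.
sumOver-cong-pairs : (x : Fin n) {f g : Subset n → ℕ} →
  (∀ A → lookup A x ≡ outside → f (A [ x ]≔ inside) + f A ≡ g (A [ x ]≔ inside) + g A) →
  sumOver f ≡ sumOver g
sumOver-cong-pairs zero {f} {g} eq = begin
  sumOver f                                  ≡⟨ sumOver-+ (f ∘ (inside ∷_)) _ ⟨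
  sumOver (λ A → f (inside ∷ A) + f (outside ∷ A)) ≡⟨ sumOver-cong (λ A → eq (outside ∷ A) refl) ⟩
  sumOver (λ A → g (inside ∷ A) + g (outside ∷ A)) ≡⟨ sumOver-+ (g ∘ (inside ∷_)) _ ⟩
  sumOver g                                  ∎
  where open ≡-Reasoning
sumOver-cong-pairs (suc x) eq =
  cong₂ _+_ (sumOver-cong-pairs x (eq ∘ (inside ∷_))) (sumOver-cong-pairs x (eq ∘ (outside ∷_)))

-- Families as Boolean predicates

-- A predicate carries no order or multiplicity, so shifts can be defined pointwise and
-- cardinalities become sums over all subsets.
SetFamily : ℕ → Set
SetFamily n = Subset n → Bool

card : SetFamily n → ℕ
card F = sumOver (⟦_⟧ ∘ F)

Uniform : ℕ → SetFamily n → Set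
Uniform k F = ∀ A → T (F A) → ∣ A ∣ ≡ k

⟦⟧≤ : ∀ b {c} → (T b → 1 ≤ c) → ⟦ b ⟧ ≤ c
⟦⟧≤ true  p = p _
⟦⟧≤ false p = z≤n

card-empty : (F : SetFamily n) → (∀ A → ¬ T (F A)) → card F ≡ 0
card-empty {zero}  F empty = n≤0⇒n≡0 (⟦⟧≤ (F []) (⊥-elim ∘ empty []))
card-empty {suc n} F empty = cong₂ _+_ (card-empty _ (empty ∘ (inside ∷_))) (card-empty _ (empty ∘ (outside ∷_)))

card-≤1 : (F : SetFamily n) → (∀ A B → T (F A) → T (F B) → A ≡ B) → card F ≤ 1
card-≤1 {zero}  F _ = ⟦⟧≤ (F []) (λ _ → s≤s z≤n)
card-≤1 {suc n} F subsingleton with anySubset? (λ A → T? (F (inside ∷ A)))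
... | yes (A , p) = subst (_≤ 1)
  (trans (sym (+-identityʳ _)) (cong (card (F ∘ (inside ∷_)) +_) (sym (card-empty _ none))))
  (card-≤1 _ sub)
  where
  none : ∀ B → ¬ T (F (outside ∷ B))
  none B q with subsingleton _ _ p q
  ... | ()
  sub : ∀ A B → T (F (inside ∷ A)) → T (F (inside ∷ B)) → A ≡ B
  sub A B p q with subsingleton _ _ p q
  ... | refl = refl
... | no ¬p rewrite card-empty (F ∘ (inside ∷_)) (λ A p → ¬p (A , p)) = card-≤1 _ sub
  where
  sub : ∀ A B → T (F (outside ∷ A)) → T (F (outside ∷ B)) → A ≡ B
  sub A B p q with subsingleton _ _ p q
  ... | refl = refl

card≤C : ∀ k (F : SetFamily n) → Uniform k F → card F ≤ n C k
card≤C {zero}  zero    F uni = ⟦⟧≤ (F []) (λ _ → s≤s z≤n)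
card≤C {zero}  (suc k) F uni = ⟦⟧≤ (F []) (λ p → contradiction (uni [] p) λ ())
card≤C {suc n} zero    F uni
  rewrite card-empty (F ∘ (inside ∷_)) (λ A p → contradiction (uni (inside ∷ A) p) λ ()) =
  ≤-trans (card≤C 0 _ (uni ∘ (outside ∷_))) (≤-reflexive (trans (nC0≡1 n) (sym (nC0≡1 (suc n)))))
card≤C {suc n} (suc k) F uni rewrite pascal n k =
  +-mono-≤ (card≤C k _ (λ A → suc-injective ∘ uni (inside ∷ A))) (card≤C (suc k) _ (uni ∘ (outside ∷_)))

-- Triple overlaps

pairs : Bool → Bool → Bool → ℕ
pairs a b c = ⟦ a ∧ b ⟧ + ⟦ b ∧ c ⟧ + ⟦ c ∧ a ⟧

-- The number `d`, counted point by point, so that proofs can recurse on the three sets together.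
overlaps : Subset n → Subset n → Subset n → ℕ
overlaps []      []      []      = 0
overlaps (a ∷ A) (b ∷ B) (c ∷ D) = pairs a b c + overlaps A B D

∣∷∣ : ∀ a (A : Subset n) → ∣ a ∷ A ∣ ≡ ⟦ a ⟧ + ∣ A ∣
∣∷∣ true  A = refl
∣∷∣ false A = refl

d≡overlaps : (A B D : Subset n) → d A B D ≡ overlaps A B D
d≡overlaps []      []      []      = refl
d≡overlaps (a ∷ A) (b ∷ B) (c ∷ D)
  rewrite sym (d≡overlaps A B D)
        | ∣∷∣ (a ∧ b) (A ∩ B) | ∣∷∣ (b ∧ c) (B ∩ D) | ∣∷∣ (c ∧ a) (D ∩ A) =
  regroup ⟦ a ∧ b ⟧ _ ⟦ b ∧ c ⟧ _ ⟦ c ∧ a ⟧ _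
  where
  regroup : ∀ p x q y r z → p + x + (q + y) + (r + z) ≡ p + q + r + (x + y + z)
  regroup = solve-∀

pairs-rotate : ∀ a b c → pairs a b c ≡ pairs b c a
pairs-rotate a b c = rotate ⟦ a ∧ b ⟧ ⟦ b ∧ c ⟧ ⟦ c ∧ a ⟧
  where
  rotate : ∀ p q r → p + q + r ≡ q + r + p
  rotate = solve-∀

pairs-swap : ∀ a b c → pairs a b c ≡ pairs b a c
pairs-swap a b c rewrite Bool.∧-comm a b | Bool.∧-comm b c | Bool.∧-comm c a = exchange ⟦ b ∧ a ⟧ ⟦ c ∧ b ⟧ ⟦ a ∧ c ⟧
  where
  exchange : ∀ p q r → p + q + r ≡ p + r + q
  exchange = solve-∀

overlap-rotate : (A B D : Subset n) → overlaps A B D ≡ overlaps B D A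
overlap-rotate []      []      []      = refl
overlap-rotate (a ∷ A) (b ∷ B) (c ∷ D) = cong₂ _+_ (pairs-rotate a b c) (overlap-rotate A B D)

overlap-swap : (A B D : Subset n) → overlaps A B D ≡ overlaps B A D
overlap-swap []      []      []      = refl
overlap-swap (a ∷ A) (b ∷ B) (c ∷ D) = cong₂ _+_ (pairs-swap a b c) (overlap-swap A B D)

overlap-update-free : ∀ x v (A B D : Subset n) → lookup B x ≡ outside → lookup D x ≡ outside →
  overlaps (A [ x ]≔ v) B D ≡ overlaps A B D
overlap-update-free zero    true  (true  ∷ A) (_ ∷ B) (_ ∷ D) refl refl = refl
overlap-update-free zero    true  (false ∷ A) (_ ∷ B) (_ ∷ D) refl refl = refl
overlap-update-free zero    false (true  ∷ A) (_ ∷ B) (_ ∷ D) refl refl = refl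
overlap-update-free zero    false (false ∷ A) (_ ∷ B) (_ ∷ D) refl refl = refl
overlap-update-free (suc x) v     (a ∷ A) (b ∷ B) (c ∷ D) p q =
  cong (pairs a b c +_) (overlap-update-free x v A B D p q)

overlap-remove : ∀ x (A B D : Subset n) → lookup A x ≡ inside → lookup B x ≡ inside →
  overlaps (A [ x ]≔ outside) B D < overlaps A B D
overlap-remove zero    (_ ∷ A) (_ ∷ B) (true  ∷ D) refl refl = n≤1+n _
overlap-remove zero    (_ ∷ A) (_ ∷ B) (false ∷ D) refl refl = ≤-refl
overlap-remove (suc x) (a ∷ A) (b ∷ B) (c ∷ D)     p    q    =
  +-monoʳ-< (pairs a b c) (overlap-remove x A B D p q)

∣insert∣ : ∀ x (A : Subset n) → lookup A x ≡ outside → ∣ A [ x ]≔ inside ∣ ≡ suc ∣ A ∣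
∣insert∣ zero    (_     ∷ A) refl = refl
∣insert∣ (suc x) (true  ∷ A) p    = cong suc (∣insert∣ x A p)
∣insert∣ (suc x) (false ∷ A) p    = ∣insert∣ x A p

∣remove∣ : ∀ x (A : Subset n) → lookup A x ≡ inside → suc ∣ A [ x ]≔ outside ∣ ≡ ∣ A ∣
∣remove∣ zero    (_     ∷ A) refl = refl
∣remove∣ (suc x) (true  ∷ A) p    = cong suc (∣remove∣ x A p)
∣remove∣ (suc x) (false ∷ A) p    = ∣remove∣ x A p

-- As long as no point lies in all three sets, each point of the union is
-- counted once in ∣A∣ + ∣B∣ + ∣D∣ ∸ overlaps A B D.
free-point : (A B D : Subset n) → ∣ A ∣ + ∣ B ∣ + ∣ D ∣ < n + overlaps A B D → overlaps A B D ≤ 2 →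
  ∃ λ x → lookup A x ≡ outside × lookup B x ≡ outside × lookup D x ≡ outside
free-point [] [] [] () _
free-point (false ∷ A) (false ∷ B) (false ∷ D) lt le = zero , refl , refl , refl
free-point (true  ∷ A) (false ∷ B) (false ∷ D) lt le = Product.map suc id (free-point A B D (s≤s⁻¹ lt) le)
free-point (false ∷ A) (true  ∷ B) (false ∷ D) lt le
  rewrite +-suc ∣ A ∣ ∣ B ∣ = Product.map suc id (free-point A B D (s≤s⁻¹ lt) le)
free-point (false ∷ A) (false ∷ B) (true  ∷ D) lt le
  rewrite +-suc (∣ A ∣ + ∣ B ∣) ∣ D ∣ = Product.map suc id (free-point A B D (s≤s⁻¹ lt) le)
free-point {suc n} (true  ∷ A) (true  ∷ B) (false ∷ D) lt le
  rewrite +-suc ∣ A ∣ ∣ B ∣ | +-suc n (overlaps A B D) =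
  Product.map suc id (free-point A B D (s≤s⁻¹ (s≤s⁻¹ lt)) (<⇒≤ le))
free-point {suc n} (true  ∷ A) (false ∷ B) (true  ∷ D) lt le
  rewrite +-suc (∣ A ∣ + ∣ B ∣) ∣ D ∣ | +-suc n (overlaps A B D) =
  Product.map suc id (free-point A B D (s≤s⁻¹ (s≤s⁻¹ lt)) (<⇒≤ le))
free-point {suc n} (false ∷ A) (true  ∷ B) (true  ∷ D) lt le
  rewrite +-suc ∣ A ∣ ∣ B ∣ | +-suc (∣ A ∣ + ∣ B ∣) ∣ D ∣ | +-suc n (overlaps A B D) =
  Product.map suc id (free-point A B D (s≤s⁻¹ (s≤s⁻¹ lt)) (<⇒≤ le))
free-point (true  ∷ A) (true  ∷ B) (true  ∷ D) lt (s≤s (s≤s ()))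

-- With overlap 0 the sets are pairwise disjoint, so any point outside `A` lies in at most one of
-- `B` and `D` and creates at most one pair. Such a point exists because `A` is not everything.
cheap-insertion : (A B D : Subset n) → ∣ A ∣ < n → overlaps A B D ≡ 0 →
  ∃ λ x → lookup A x ≡ outside × overlaps (A [ x ]≔ inside) B D ≤ 1
cheap-insertion [] [] [] () _
cheap-insertion (true  ∷ A) (false ∷ B) (false ∷ D) lt eq = Product.map suc id (cheap-insertion A B D (s≤s⁻¹ lt) eq)
cheap-insertion (false ∷ A) (false ∷ B) (false ∷ D) lt eq = zero , refl , ≤-trans (≤-reflexive eq) z≤n
cheap-insertion (false ∷ A) (true  ∷ B) (false ∷ D) lt eq = zero , refl , s≤s (≤-reflexive eq)
cheap-insertion (false ∷ A) (false ∷ B) (true  ∷ D) lt eq = zero , refl , s≤s (≤-reflexive eq)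

Overlapping : SetFamily n → Set
Overlapping F = ∀ {A B D} → T (F A) → T (F B) → T (F D) → 3 ≤ overlaps A B D

-- Shifting the head element into x

update-same : ∀ x (A : Subset n) {v} → lookup A x ≡ v → A [ x ]≔ v ≡ A
update-same x A refl = []≔-lookup A x

transpose : Fin n → Subset (suc n) → Subset (suc n)
transpose x (a ∷ A) = lookup A x ∷ (A [ x ]≔ a)

overlap-transpose : ∀ x (S U V : Subset (suc n)) →
  overlaps (transpose x S) (transpose x U) (transpose x V) ≡ overlaps S U V
overlap-transpose x (a ∷ A) (b ∷ B) (c ∷ D) = go x A B D
  where
  exchange : ∀ p q r → p + (q + r) ≡ q + (p + r)
  exchange = solve-∀
  go : ∀ {n} (x : Fin n) A B D → pairs (lookup A x) (lookup B x) (lookup D x)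
    + overlaps (A [ x ]≔ a) (B [ x ]≔ b) (D [ x ]≔ c) ≡ pairs a b c + overlaps A B D
  go zero (p ∷ A) (q ∷ B) (r ∷ D) = exchange (pairs p q r) (pairs a b c) _
  go (suc x) (p ∷ A) (q ∷ B) (r ∷ D) = trans (exchange (pairs (lookup A x) _ _) (pairs p q r) (overlaps (A [ x ]≔ a) _ _))
    (trans (cong (pairs p q r +_) (go x A B D)) (exchange (pairs p q r) (pairs a b c) _))

transpose-involutive : ∀ x (S : Subset (suc n)) → transpose x (transpose x S) ≡ S
transpose-involutive x (a ∷ A) = cong₂ _∷_ (lookup∘update x A a)
  (trans ([]≔-idempotent A x) ([]≔-lookup A x))

-- The usual shift operator, as a membership test for the new family: a member with the head but
-- without `x` is replaced by its transpose, unless the transpose is a member already.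
shift : Fin n → SetFamily (suc n) → SetFamily (suc n)
shift x F (true  ∷ A) = F (true ∷ A) ∧ (lookup A x ∨ F (false ∷ (A [ x ]≔ inside)))
shift x F (false ∷ A) = F (false ∷ A) ∨ (lookup A x ∧ F (true ∷ (A [ x ]≔ outside)))

-- The sets which the transposition moves against the direction of the shift.
data Shifted {n} (x : Fin n) : Subset (suc n) → Set where
  shifted : ∀ {A} → lookup A x ≡ inside → Shifted x (outside ∷ A)

-- A member of the shifted family that is not `Shifted` is either fixed by the transposition or was
-- kept because its transpose was present, so it and its transpose both lie in `F`. For a `Shifted`
-- member only one of the two is guaranteed.
data Origin {n} (x : Fin n) (F : SetFamily (suc n)) (S : Subset (suc n)) : Set where
  both  : T (F S) → T (F (transpose x S)) → Origin x F S
  old   : Shifted x S → T (F S) → Origin x F S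
  moved : Shifted x S → T (F (transpose x S)) → Origin x F S

origin : ∀ x (F : SetFamily (suc n)) S → T (shift x F S) → Origin x F S
origin x F (true ∷ A) p with Equivalence.to (Bool.T-∧ {F (true ∷ A)} {lookup A x ∨ _}) p
... | q , p′ with lookup A x in eq
...   | true  = both q (subst (T ∘ F) (cong₂ _∷_ (sym eq) (sym (update-same x A eq))) q)
...   | false = both q (subst (λ v → T (F (v ∷ (A [ x ]≔ inside)))) (sym eq) p′)
origin x F (false ∷ A) p with Equivalence.to (Bool.T-∨ {F (false ∷ A)} {lookup A x ∧ _}) p
... | inj₁ q with lookup A x in eq
...   | true  = old (shifted eq) q
...   | false = both q (subst (T ∘ F) (cong₂ _∷_ (sym eq) (sym (update-same x A eq))) q)
origin x F (false ∷ A) p | inj₂ p′ with lookup A x in eq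
...   | true  = moved (shifted eq) (subst (λ v → T (F (v ∷ (A [ x ]≔ outside)))) (sym eq) p′)

-- Undoing the move of `S` destroys the pair `S`, `U` at `x` and creates at most the pair `S`, `V`
-- at the head.
overlap-unshift : ∀ {x} {S U : Subset (suc n)} → Shifted x S → Shifted x U → ∀ V →
  overlaps (transpose x S) U V ≤ overlaps S U V
overlap-unshift {x = x} {_ ∷ A} {_ ∷ B} (shifted p) (shifted q) (c ∷ D) rewrite p with c
... | true  = overlap-remove x A B D p q
... | false = <⇒≤ (overlap-remove x A B D p q)

module _ (x : Fin n) (F : SetFamily (suc n)) (ov : Overlapping F) where

  private
    all-moved : ∀ {S U V} → T (F (transpose x S)) → T (F (transpose x U)) → T (F (transpose x V)) → 3 ≤ overlaps S U V
    all-moved {S} {U} {V} p q r = subst (3 ≤_) (overlap-transpose x S U V) (ov p q r)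

    -- The mixed case: `S` is known to `F` only through its transpose and `U` only as itself, so
    -- neither the triple nor its transpose need lie in `F`. Both sets are `Shifted`, so transposing
    -- just one of them cannot raise the overlap.
    moved-old : ∀ {S U V} → Shifted x S → T (F (transpose x S)) → Shifted x U → T (F U) →
      Origin x F V → 3 ≤ overlaps S U V
    moved-old {S} {U} {V} s p u q = λ
      { (both r _)  → stays r
      ; (old _ r)   → stays r
      ; (moved _ r) → moves r
      }
      where
      stays : T (F V) → 3 ≤ overlaps S U V
      stays r = ≤-trans (ov p q r) (overlap-unshift s u V)
      -- Transposing the triple (transpose S, U, transpose V) moves U alone.
      moves : T (F (transpose x V)) → 3 ≤ overlaps S U V
      moves r = subst (3 ≤_) (overlap-swap U S V) (≤-trans (≤-trans (ov q p r) (≤-reflexive lem)) (overlap-unshift u s V))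
        where
        lem : overlaps U (transpose x S) (transpose x V) ≡ overlaps (transpose x U) S V
        lem = trans (sym (overlap-transpose x U (transpose x S) (transpose x V)))
          (cong₂ (overlaps (transpose x U)) (transpose-involutive x S) (transpose-involutive x V))

    some-moved : ∀ {S U V} → Shifted x S → T (F (transpose x S)) → Origin x F U → Origin x F V → 3 ≤ overlaps S U V
    some-moved s p (old u q)   o           = moved-old s p u q o
    some-moved {S} {U} {V} s p o (old v r) =
      subst (3 ≤_) (trans (overlap-swap S V U) (overlap-rotate V S U)) (moved-old s p v r o)
    some-moved s p (both _ q)  (both _ r)  = all-moved p q r
    some-moved s p (both _ q)  (moved _ r) = all-moved p q r
    some-moved s p (moved _ q) (both _ r)  = all-moved p q r
    some-moved s p (moved _ q) (moved _ r) = all-moved p q r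

    from-origins : ∀ {S U V} → Origin x F S → Origin x F U → Origin x F V → 3 ≤ overlaps S U V
    from-origins (moved s p) o₁          o₂          = some-moved s p o₁ o₂
    from-origins {S} {U} {V} o₁ (moved u q) o₂       =
      subst (3 ≤_) (overlap-swap U S V) (some-moved u q o₁ o₂)
    from-origins {S} {U} {V} o₁ o₂ (moved v r)       =
      subst (3 ≤_) (overlap-rotate V S U) (some-moved v r o₁ o₂)
    -- From here on no set was moved, so the triple itself lies in `F`.
    from-origins (both p _)  (both q _)  (both r _)  = ov p q r
    from-origins (both p _)  (both q _)  (old _ r)   = ov p q r
    from-origins (both p _)  (old _ q)   (both r _)  = ov p q r
    from-origins (both p _)  (old _ q)   (old _ r)   = ov p q r
    from-origins (old _ p)   (both q _)  (both r _)  = ov p q r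
    from-origins (old _ p)   (both q _)  (old _ r)   = ov p q r
    from-origins (old _ p)   (old _ q)   (both r _)  = ov p q r
    from-origins (old _ p)   (old _ q)   (old _ r)   = ov p q r

  shift-overlapping : Overlapping (shift x F)
  shift-overlapping {S} {U} {V} p q r = from-origins (origin x F S p) (origin x F U q) (origin x F V r)

∣transpose∣ : ∀ x (S : Subset (suc n)) → ∣ transpose x S ∣ ≡ ∣ S ∣
∣transpose∣ x (a ∷ A) with lookup A x in eq
∣transpose∣ x (true  ∷ A) | true  = cong suc (cong ∣_∣ (update-same x A eq))
∣transpose∣ x (false ∷ A) | true  = ∣remove∣ x A eq
∣transpose∣ x (true  ∷ A) | false = ∣insert∣ x A eq
∣transpose∣ x (false ∷ A) | false = cong ∣_∣ (update-same x A eq)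

shift-uniform : ∀ x {F : SetFamily (suc n)} → Uniform k F → Uniform k (shift x F)
shift-uniform x {F} uni S p with origin x F S p
... | both q _  = uni S q
... | old _ q   = uni S q
... | moved _ q = trans (sym (∣transpose∣ x S)) (uni _ q)

-- Over A and A ∪ {x}, each with and without the head, four sets are involved. The shift changes the
-- membership bits of two of them only, from `q` and `r` to `q ∨ r` and `r ∧ q`, which have the same
-- sum.
card-shift : ∀ x (F : SetFamily (suc n)) → card (shift x F) ≡ card F
card-shift x F = begin
  card (shift x F)                    ≡⟨ sumOver-+ (⟦_⟧ ∘ shift x F ∘ (inside ∷_)) _ ⟨
  sumOver after                       ≡⟨ sumOver-cong-pairs x paired ⟩
  sumOver before                      ≡⟨ sumOver-+ (⟦_⟧ ∘ F ∘ (inside ∷_)) _ ⟩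
  card F                              ∎
  where
  open ≡-Reasoning
  after before : Subset _ → ℕ
  after A  = ⟦ shift x F (inside ∷ A) ⟧ + ⟦ shift x F (outside ∷ A) ⟧
  before A = ⟦ F (inside ∷ A) ⟧ + ⟦ F (outside ∷ A) ⟧
  bits : ∀ p q r s → ⟦ p ∧ true ⟧ + ⟦ q ∨ r ⟧ + (⟦ r ∧ q ⟧ + ⟦ s ∨ false ⟧) ≡ ⟦ p ⟧ + ⟦ q ⟧ + (⟦ r ⟧ + ⟦ s ⟧)
  bits p q r s rewrite Bool.∧-identityʳ p | Bool.∨-identityʳ s with q | r
  ... | true  | true  = refl
  ... | true  | false = refl
  ... | false | false = refl
  ... | false | true  = move ⟦ p ⟧ ⟦ s ⟧
    where
    move : ∀ a b → a + 1 + b ≡ a + 0 + suc b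
    move = solve-∀
  paired : ∀ A → lookup A x ≡ outside → after (A [ x ]≔ inside) + after A ≡ before (A [ x ]≔ inside) + before A
  paired A eq
    rewrite lookup∘update x A inside | eq | []≔-idempotent {x = inside} {y = outside} A x | update-same x A eq =
    bits (F (true ∷ (A [ x ]≔ inside))) (F (false ∷ (A [ x ]≔ inside))) (F (true ∷ A)) (F (false ∷ A))

-- Stable families

Stable : SetFamily (suc n) → Set
Stable F = ∀ x A → T (F (inside ∷ A)) → lookup A x ≡ outside → T (F (outside ∷ (A [ x ]≔ inside)))

-- The link of the head element; `lower` is the deletion.
upper : SetFamily (suc n) → SetFamily n
upper F A = F (inside ∷ A)

lower : SetFamily (suc n) → SetFamily n
lower F A = F (outside ∷ A)

⟦∧⟧≤ : ∀ b c → ⟦ b ∧ c ⟧ ≤ ⟦ b ⟧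
⟦∧⟧≤ true  true  = ≤-refl
⟦∧⟧≤ true  false = z≤n
⟦∧⟧≤ false c     = z≤n

upper-shift-< : ∀ x (F : SetFamily (suc n)) A → T (F (inside ∷ A)) → lookup A x ≡ outside →
  ¬ T (F (outside ∷ (A [ x ]≔ inside))) → card (upper (shift x F)) < card (upper F)
upper-shift-< x F A p eq ¬q = sumOver-mono-< (λ B → ⟦∧⟧≤ (F (inside ∷ B)) _) A drop
  where
  drop : ⟦ shift x F (inside ∷ A) ⟧ < ⟦ F (inside ∷ A) ⟧
  drop rewrite eq with F (inside ∷ A) | F (outside ∷ (A [ x ]≔ inside))
  ... | true | true  = ⊥-elim (¬q _)
  ... | true | false = s≤s z≤n

-- Every effective shift decreases the number of members containing the head.
stabilise : (F : SetFamily (suc n)) → Uniform k F → Overlapping F →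
  ∃ λ (G : SetFamily (suc n)) → Uniform k G × Overlapping G × Stable G × card G ≡ card F
stabilise {n} {k} F = <-rec P step (card (upper F)) F refl
  where
  P : ℕ → Set
  P c = (F : SetFamily (suc n)) → card (upper F) ≡ c → Uniform k F → Overlapping F →
    ∃ λ (G : SetFamily (suc n)) → Uniform k G × Overlapping G × Stable G × card G ≡ card F
  Violates : SetFamily (suc n) → Fin n → Subset n → Set
  Violates F x A = T (F (inside ∷ A)) × lookup A x ≡ outside × ¬ T (F (outside ∷ (A [ x ]≔ inside)))
  violates? : ∀ F → Dec (∃ λ x → ∃ (Violates F x))
  violates? F = any? λ x → anySubset? λ A → T? _ ×-dec (lookup A x Bool.≟ outside ×-dec ¬? (T? _))
  step : ∀ c → (∀ {c′} → c′ < c → P c′) → P c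
  step c rec F refl uni ov with violates? F
  ... | no ¬v = F , uni , ov , (λ x A p q → decidable-stable (T? _) λ ¬r → ¬v (x , A , p , q , ¬r)) , refl
  ... | yes (x , A , p , q , ¬r)
    with rec (upper-shift-< x F A p q ¬r) (shift x F) refl (shift-uniform x uni)
           (λ {S} {U} {V} → shift-overlapping x F ov {S} {U} {V})
  ...   | G , uni′ , ov′ , st , eq = G , uni′ , ov′ , st , trans eq (card-shift x F)

-- The link of the head in a stable family

-- The head itself accounts for three pairs. If the rest had overlap at most 2, stability would let
-- the head be exchanged for another point in one set, leaving one pair at the head, or in two sets,
-- leaving none. The bound on `m` supplies the points, and the resulting members of `F` would have
-- overlap at most 2.
upper-overlapping : ∀ {j} {F : SetFamily (suc m)} → 3 * suc j ≤ m → Uniform (suc (suc j)) F →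
  Stable F → Overlapping F → Overlapping (upper F)
upper-overlapping {m} {j} {F} 3k≤m uni st ov {A} {B} {D} p q r = go (overlaps A B D) refl
  where
  size : ∀ {S} → T (upper F S) → ∣ S ∣ ≡ suc j
  size {S} t = suc-injective (uni (inside ∷ S) t)
  total≤m : ∣ A ∣ + ∣ B ∣ + ∣ D ∣ ≤ m
  total≤m rewrite size p | size q | size r = subst (_≤ m) (triple (suc j)) 3k≤m
    where
    triple : ∀ s → 3 * s ≡ s + s + s
    triple = solve-∀
  ∣A∣<m : ∣ A ∣ < m
  ∣A∣<m rewrite size p = <-≤-trans (m<m+n (suc j) (s≤s z≤n)) 3k≤m
  absent : ∀ {c} → overlaps A B D ≡ suc c → c ≤ 1 →
    ∃ λ x → lookup A x ≡ outside × lookup B x ≡ outside × lookup D x ≡ outside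
  absent {c} eq c≤1 = free-point A B D
    (≤-<-trans total≤m (subst (λ z → m < m + z) (sym eq) (m<m+n m (s≤s z≤n))))
    (subst (_≤ 2) (sym eq) (s≤s c≤1))
  go : ∀ c → overlaps A B D ≡ c → 3 ≤ overlaps A B D
  -- Three disjoint sets may cover all `m` points, so `x` is only required to avoid `A`; the one
  -- pair it may create is affordable.
  go 0 eq with cheap-insertion A B D ∣A∣<m eq
  ... | x , x∉A , le = contradiction (ov (st x A p x∉A) q r) (<⇒≱ (s≤s (s≤s le)))
  go 1 eq with absent eq z≤n
  ... | x , x∉A , x∉B , x∉D = contradiction (ov (st x A p x∉A) q r)
    (<⇒≱ (s≤s (s≤s (≤-reflexive (trans (overlap-update-free x inside A B D x∉B x∉D) eq)))))
  -- Moving the head out of `A` alone leaves the pair `B`, `D` at the head and total 3, so it must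
  -- leave `B` too. The second point `y` also has to avoid `x`; overlap 2 leaves room for it
  -- although `A′` is one larger than `A`.
  go 2 eq with absent eq ≤-refl
  ... | x , x∉A , x∉B , x∉D with free-point A′ B D total′ (≤-reflexive eq′)
    where
    A′ = A [ x ]≔ inside
    eq′ : overlaps A′ B D ≡ 2
    eq′ = trans (overlap-update-free x inside A B D x∉B x∉D) eq
    total′ : ∣ A′ ∣ + ∣ B ∣ + ∣ D ∣ < m + overlaps A′ B D
    total′ rewrite eq′ | ∣insert∣ x A x∉A | +-comm m 2 = s≤s (s≤s total≤m)
  ...   | y , y∉A′ , y∉B , y∉D = contradiction (ov (st x A p x∉A) (st y B q y∉B) r)
    (<⇒≱ (s≤s (≤-reflexive spread)))
    where
    open ≡-Reasoning
    A′ = A [ x ]≔ inside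
    B′ = B [ y ]≔ inside
    spread : overlaps A′ B′ D ≡ 2
    spread = begin
      overlaps A′ B′ D ≡⟨ overlap-swap A′ B′ D ⟩
      overlaps B′ A′ D ≡⟨ overlap-update-free y inside B A′ D y∉A′ y∉D ⟩
      overlaps B A′ D  ≡⟨ overlap-swap B A′ D ⟩
      overlaps A′ B D  ≡⟨ overlap-update-free x inside A B D x∉B x∉D ⟩
      overlaps A B D   ≡⟨ eq ⟩
      2                ∎
  go (suc (suc (suc _))) eq = subst (3 ≤_) (sym eq) (s≤s (s≤s (s≤s z≤n)))

-- The case k = 1 and the induction on n

∩-full⇒≡ : (A B : Subset n) → ∣ A ∣ ≤ ∣ A ∩ B ∣ → ∣ B ∣ ≤ ∣ A ∩ B ∣ → A ≡ B
∩-full⇒≡ []          []          _ _ = refl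
∩-full⇒≡ (true  ∷ A) (true  ∷ B) p q = cong (inside ∷_) (∩-full⇒≡ A B (s≤s⁻¹ p) (s≤s⁻¹ q))
∩-full⇒≡ (true  ∷ A) (false ∷ B) p q = contradiction (≤-trans p (∣p∩q∣≤∣p∣ A B)) 1+n≰n
∩-full⇒≡ (false ∷ A) (true  ∷ B) p q = contradiction (≤-trans q (∣p∩q∣≤∣q∣ A B)) 1+n≰n
∩-full⇒≡ (false ∷ A) (false ∷ B) p q = cong (outside ∷_) (∩-full⇒≡ A B p q)

-- The triple `A`, `A`, `B` has overlap 1 + 2|A ∩ B|, which reaches 3 only if the two singletons
-- meet.
overlapping-singletons : {F : SetFamily n} → Uniform 1 F → Overlapping F → ∀ A B → T (F A) → T (F B) → A ≡ B
overlapping-singletons uni ov A B p q = ∩-full⇒≡ A B (met (uni A p)) (met (uni B q))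
  where
  1≤ : ∀ t → 3 ≤ 1 + t + t → 1 ≤ t
  1≤ zero    (s≤s ())
  1≤ (suc t) _ = s≤s z≤n
  3≤ : 3 ≤ 1 + ∣ A ∩ B ∣ + ∣ A ∩ B ∣
  3≤ = subst (3 ≤_) (trans (sym (d≡overlaps A A B))
    (cong₂ (λ a b → a + ∣ A ∩ B ∣ + b) (trans (cong ∣_∣ (∩-idem A)) (uni A p)) (cong ∣_∣ (∩-comm B A))))
    (ov p p q)
  met : ∀ {s} → s ≡ 1 → s ≤ ∣ A ∩ B ∣
  met refl = 1≤ _ 3≤

card≤bound : ∀ n j (F : SetFamily n) → 3 * j ≤ n → Uniform (suc j) F → Overlapping F → card F ≤ bound n j
card≤bound n       zero    F _    uni ov =
  subst (card F ≤_) (sym (nC0≡1 n)) (card-≤1 F (overlapping-singletons uni ov))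
card≤bound (suc m) (suc i) F 3j≤n uni ov with 3 * suc i ≤? m
-- Now n = 3j, and the size of the whole layer is already within the bound.
... | no 3j≰m = ≤-trans (card≤C _ F uni)
  (subst (λ z → z C suc (suc i) ≤ bound z (suc i)) (≤-antisym 3j≤n (≰⇒> 3j≰m)) (layer≤bound i))
... | yes 3j≤m with stabilise F uni ov
...   | G , uni′ , ov′ , st , eq =
  subst₂ _≤_ eq (sym (bound-pascal (≤-trans (s≤s z≤n) 3j≤m) i)) (+-mono-≤
    (card≤bound m i (upper G) (≤-trans (*-monoʳ-≤ 3 (n≤1+n i)) 3j≤m)
      (λ A → suc-injective ∘ uni′ (inside ∷ A)) (upper-overlapping 3j≤m uni′ st ov′))
    (card≤bound m (suc i) (lower G) 3j≤m (uni′ ∘ (outside ∷_)) ov′))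

-- From Boolean families back to lists, `g` and `binom`

length-filter-map : ∀ {X Y : Set} {P : Y → Set} (P? : Decidable P) (f : X → Y) xs →
  length (filter P? (map f xs)) ≡ length (filter (P? ∘ f) xs)
length-filter-map P? f []       = refl
length-filter-map P? f (x ∷ xs) with does (P? (f x))
... | true  = cong suc (length-filter-map P? f xs)
... | false = length-filter-map P? f xs

length-filter-subsets : ∀ n {P : Subset n → Set} (P? : Decidable P) →
  length (filter P? (subsets n)) ≡ card (does ∘ P?)
length-filter-subsets zero    P? with does (P? [])
... | true  = refl
... | false = refl
length-filter-subsets (suc n) P? = begin
  length (filter P? (ins ++ outs))                    ≡⟨ cong length (filter-++ P? ins outs) ⟩
  length (filter P? ins ++ filter P? outs)            ≡⟨ length-++ (filter P? ins) ⟩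
  length (filter P? ins) + length (filter P? outs)    ≡⟨ cong₂ _+_ (half inside) (half outside) ⟩
  card (does ∘ P?)                                    ∎
  where
  open ≡-Reasoning
  ins  = map (inside ∷_) (subsets n)
  outs = map (outside ∷_) (subsets n)
  half : ∀ v → length (filter P? (map (v ∷_) (subsets n))) ≡ card (does ∘ P? ∘ (v ∷_))
  half v = trans (length-filter-map P? (v ∷_) (subsets n)) (length-filter-subsets n (P? ∘ (v ∷_)))

g≤bound : ∀ n j → 3 * j ≤ n → g n (suc j) 3 ≤ bound n j
g≤bound n j 3j≤n with g-attained n (suc j) 3
... | 𝓕 , (unique , uniform , h) , eq = subst (_≤ bound n j) (trans (sym count≡length) eq)
  (card≤bound n j (does ∘ _∈𝓕?) 3j≤n
    (λ A p → All.lookup uniform (member p))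
    (λ {A} {B} {D} p q r → subst (3 ≤_) (d≡overlaps A B D) (h (member p) (member q) (member r))))
  where
  _∈𝓕? : Decidable (_∈ 𝓕)
  A ∈𝓕? = Any.any? (≡-dec Bool._≟_ A) 𝓕
  member : ∀ {A} → T (does (A ∈𝓕?)) → A ∈ 𝓕
  member {A} p with A ∈𝓕?
  ... | yes A∈ = A∈
  -- `𝓕` may be ordered differently from `subsets n`; both lists are duplicate-free with the same
  -- elements, hence permutations of each other.
  count≡length : length 𝓕 ≡ card (does ∘ _∈𝓕?)
  count≡length = trans
    (↭-length (∼bag⇒↭ (unique∧set⇒bag unique (Unique.filter⁺ _∈𝓕? (subsets-unique n))
      (mk⇔ (λ A∈ → ∈-filter⁺ _∈𝓕? (∈-subsets _) A∈) (proj₂ ∘ ∈-filter⁻ _∈𝓕? {xs = subsets n})))))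
    (length-filter-subsets n _∈𝓕?)

open import Data.Integer using (+_; _-_)

theorem2p2 : ∀ (n k : ℕ) → 0 < n → 0 < k → n ≥ 3 * k ∸ 3 → 3 * k ∸ 3 ≥ 3 →
    g n k 3 ≤ binom n (+ k - + 1) + 2 * binom n (+ k - + 3) + 3 * binom (n ∸ 1) (+ k - + 3)
theorem2p2 n (suc j) _ _ n≥ _ = ≤-trans (g≤bound n j 3j≤n) (bound≤ j)
  where
  3k∸3 : ∀ j → 3 * suc j ∸ 3 ≡ 3 * j
  3k∸3 j = cong (_∸ 3) (*-suc 3 j)
  3j≤n : 3 * j ≤ n
  3j≤n = subst (_≤ n) (3k∸3 j) n≥
  bound≤ : ∀ j → bound n j ≤
    binom n (+ suc j - + 1) + 2 * binom n (+ suc j - + 3) + 3 * binom (n ∸ 1) (+ suc j - + 3)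
  -- For k = 1 and k = 2 the lower index k - 3 is negative, so only the first term is nonzero.
  bound≤ zero          = ≤-trans (m≤m+n _ 0) (m≤m+n _ 0)
  bound≤ (suc zero)    = ≤-trans (m≤m+n _ 0) (m≤m+n _ 0)
  bound≤ (suc (suc i)) = ≤-refl
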